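{- If $(S,K,I)$ is a split graph and $C$ is an induced cycle in the factor graph $\Phi(S)$, then $|C|\leq 4$.
   Context: A split graph $(S,K,I)$ is a graph $S$ together with a fixed partition $V(S)=K\dot\cup I$, where $K$ is a clique and $I$ is an independent set. For a vertex $v$ of $S$, $N_v$ denotes its open neighborhood in $S$ and $d_v=|N_v|$; $\eta_{uv}=|N_u\cap N_v|$. The factor graph $\Phi(S)$ is the loopless multigraph with vertex set $I$ in which, for distinct $u,v\in I$, there is one edge joining $u$ and $v$ for each 2-switch of $S$ acting on $u$ and $v$ (a 2-switch replaces edges $ab,cd$ with $ac,bd$ when $ab,cd\in E(S)$ and $ac,bd\notin E(S)$); equivalently, the multiplicity of $uv$ is $\sigma_{uv}=(d_u-\eta_{uv})(d_v-\eta_{uv})$, and $u,v$ are adjacent iff $\sigma_{uv}>0$. An induced cycle $C=v_1\ldots v_nv_1$ ($n\geq 3$) in $\Phi(S)$ consists of distinct vertices with $v_iv_{i+1}$ and $v_nv_1$ adjacent and no other pair adjacent (multiplicities ignored); $|C|=n$. -}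

module Defs where

open import Data.Empty using (⊥-elim)
open import Data.Fin using (Fin; toℕ; _<_)
open import Data.Fin.Properties using (_≟_)
open import Data.Fin.Subset using (Subset; _∈_; _∉_)
open import Data.Fin.Subset.Properties using (_∈?_)
open import Data.Nat using (ℕ; suc; _≤_)
open import Data.Product using (Σ; ∃; _×_; _,_; proj₁; proj₂)
open import Data.Product.Properties using (Σ-≡,≡→≡)
open import Data.Sum using (_⊎_; inj₁; inj₂)
open import Data.Vec.Properties.WithK using ([]=-irrelevant)
open import Function.Definitions using (Injective)
open import Relation.Nullary using (Dec; ¬_; ¬?; recompute)
open import Relation.Nullary.Decidable using (map′; _×-dec_)
open import Relation.Binary.PropositionalEquality using (_≡_; _≢_; refl; sym)

-- Finite simple graphs on the vertex set Fin m; N v is the open neighbourhood.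
record Graph (m : ℕ) : Set where
  field
    N : Fin m → Subset m

  _~_ : Fin m → Fin m → Set
  u ~ v = v ∈ N u

  field
    ~-sym    : ∀ {u v} → u ~ v → v ~ u
    ~-irrefl : ∀ {v} → ¬ (v ~ v)

record SplitGraph (m : ℕ) : Set where
  field
    graph : Graph m

  open Graph graph public

  field
    K I         : Subset m
    cover       : ∀ v → v ∈ K ⊎ v ∈ I
    disjoint    : ∀ {v} → v ∈ K → v ∉ I
    clique      : ∀ {u v} → u ∈ K → v ∈ K → u ≢ v → u ~ v
    independent : ∀ {u v} → u ∈ I → v ∈ I → ¬ (u ~ v)

-- The edges ab, cd can be replaced with ac, bd.  The remaining inequalities
-- between a, b, c, d follow from the (non-)adjacencies.
record IsTwoSwitch {m : ℕ} (G : Graph m) (a b c d : Fin m) : Set where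
  open Graph G
  field
    a≢c  : a ≢ c
    b≢d  : b ≢ d
    ab∈E : a ~ b
    cd∈E : c ~ d
    ac∉E : ¬ (a ~ c)
    bd∉E : ¬ (b ~ d)

isTwoSwitch? : ∀ {m} (G : Graph m) a b c d → Dec (IsTwoSwitch G a b c d)
isTwoSwitch? G a b c d =
  map′ (λ (p , q , r , s , t , u) → record
          { a≢c = p ; b≢d = q ; ab∈E = r ; cd∈E = s ; ac∉E = t ; bd∉E = u })
       (λ w → let open IsTwoSwitch w in a≢c , b≢d , ab∈E , cd∈E , ac∉E , bd∉E)
       (¬? (a ≟ c) ×-dec ¬? (b ≟ d) ×-dec (b ∈? N a) ×-dec (d ∈? N c)
         ×-dec ¬? (c ∈? N a) ×-dec ¬? (d ∈? N b))
  where open Graph G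

-- The arrays (a,b,c,d), (b,a,d,c), (c,d,a,b), (d,c,b,a) denote the same
-- replacement {ab,cd} ↦ {ac,bd}.  Each of the four vertices comes first in
-- exactly one of them, so requiring the first entry to be the least one selects
-- one array per 2-switch.  The proofs are irrelevant so that a 2-switch is
-- determined by its array.
record TwoSwitch {m : ℕ} (G : Graph m) : Set where
  field
    a b c d  : Fin m
    .a-least : a < b × a < c × a < d
    .valid   : IsTwoSwitch G a b c d

  ActsOn : Fin m → Set
  ActsOn x = x ≡ a ⊎ x ≡ b ⊎ x ≡ c ⊎ x ≡ d

isTwoSwitch : ∀ {m} {G : Graph m} (s : TwoSwitch G) →
              let open TwoSwitch s in IsTwoSwitch G a b c d
isTwoSwitch {G = G} record { a = a ; b = b ; c = c ; d = d ; valid = w } =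
  recompute (isTwoSwitch? G a b c d) w

-- Loopless multigraphs: every edge joins exactly one unordered pair of
-- distinct vertices.
record Multigraph : Set₁ where
  field
    Vertex       : Set
    Edge         : Set
    Joins        : Edge → Vertex → Vertex → Set
    joins-sym    : ∀ {e u v} → Joins e u v → Joins e v u
    loopless     : ∀ {e v} → ¬ Joins e v v
    joins-exists : ∀ e → ∃ λ u → ∃ λ v → Joins e u v
    joins-unique : ∀ {e u v u′ v′} → Joins e u v → Joins e u′ v′ →
                   (u ≡ u′ × v ≡ v′) ⊎ (u ≡ v′ × v ≡ u′)

  Adjacent : Vertex → Vertex → Set
  Adjacent u v = ∃ λ e → Joins e u v

module _ {m : ℕ} (S : SplitGraph m) where
  open SplitGraph S

  ΦVertex : Set
  ΦVertex = Σ (Fin m) (_∈ I)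

  ΦJoins : TwoSwitch graph → ΦVertex → ΦVertex → Set
  ΦJoins s u v = u ≢ v × ActsOn (proj₁ u) × ActsOn (proj₁ v)
    where open TwoSwitch s

  private
    ≡-vertex : {u v : ΦVertex} → proj₁ u ≡ proj₁ v → u ≡ v
    ≡-vertex p = Σ-≡,≡→≡ (p , []=-irrelevant _ _)

    ~⇒K : ∀ {x y} → x ∈ I → x ~ y → y ∈ K
    ~⇒K {y = y} x∈I x~y with cover y
    ... | inj₁ y∈K = y∈K
    ... | inj₂ y∈I = ⊥-elim (independent x∈I y∈I x~y)

    ≁⇒I : ∀ {x y} → x ∈ K → x ≢ y → ¬ (x ~ y) → y ∈ I
    ≁⇒I {y = y} x∈K x≢y x≁y with cover y
    ... | inj₁ y∈K = ⊥-elim (x≁y (clique x∈K y∈K x≢y))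
    ... | inj₂ y∈I = y∈I

    module _ (s : TwoSwitch graph) where
      open TwoSwitch s
      open IsTwoSwitch (isTwoSwitch s)

      -- p and q are the only vertices of I that s acts on
      Ends : Fin m → Fin m → Set
      Ends p q = p ∈ I × q ∈ I × p ≢ q × ActsOn p × ActsOn q ×
                 (∀ {x} → x ∈ I → ActsOn x → x ≡ p ⊎ x ≡ q)

      ends : ∃ λ p → ∃ λ q → Ends p q
      ends with cover a
      ... | inj₂ a∈I = a , d , a∈I , d∈I , (λ { refl → ac∉E (~-sym cd∈E) }) ,
                       inj₁ refl , inj₂ (inj₂ (inj₂ refl)) , only
        where
        b∈K : b ∈ K
        b∈K = ~⇒K a∈I ab∈E
        d∈I : d ∈ I
        d∈I = ≁⇒I b∈K b≢d bd∉E
        c∈K : c ∈ K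
        c∈K = ~⇒K d∈I (~-sym cd∈E)
        only : ∀ {x} → x ∈ I → ActsOn x → x ≡ a ⊎ x ≡ d
        only x∈I (inj₁ x≡a)               = inj₁ x≡a
        only x∈I (inj₂ (inj₁ refl))        = ⊥-elim (disjoint b∈K x∈I)
        only x∈I (inj₂ (inj₂ (inj₁ refl))) = ⊥-elim (disjoint c∈K x∈I)
        only x∈I (inj₂ (inj₂ (inj₂ x≡d)))  = inj₂ x≡d
      ... | inj₁ a∈K = b , c , b∈I , c∈I , (λ { refl → ac∉E ab∈E }) ,
                       inj₂ (inj₁ refl) , inj₂ (inj₂ (inj₁ refl)) , only
        where
        c∈I : c ∈ I
        c∈I = ≁⇒I a∈K a≢c ac∉E
        d∈K : d ∈ K
        d∈K = ~⇒K c∈I cd∈E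
        b∈I : b ∈ I
        b∈I = ≁⇒I d∈K (λ d≡b → b≢d (sym d≡b)) (λ d~b → bd∉E (~-sym d~b))
        only : ∀ {x} → x ∈ I → ActsOn x → x ≡ b ⊎ x ≡ c
        only x∈I (inj₁ refl)               = ⊥-elim (disjoint a∈K x∈I)
        only x∈I (inj₂ (inj₁ x≡b))         = inj₁ x≡b
        only x∈I (inj₂ (inj₂ (inj₁ x≡c)))  = inj₂ x≡c
        only x∈I (inj₂ (inj₂ (inj₂ refl))) = ⊥-elim (disjoint d∈K x∈I)

      Φjoins-exists : ∃ λ u → ∃ λ v → ΦJoins s u v
      Φjoins-exists with ends
      ... | p , q , p∈I , q∈I , p≢q , p-on , q-on , _ =
        (p , p∈I) , (q , q∈I) , (λ { refl → p≢q refl }) , p-on , q-on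

      Φjoins-unique : ∀ {u v u′ v′} → ΦJoins s u v → ΦJoins s u′ v′ →
                      (u ≡ u′ × v ≡ v′) ⊎ (u ≡ v′ × v ≡ u′)
      Φjoins-unique {_ , u∈} {_ , v∈} {_ , u′∈} {_ , v′∈}
        (u≢v , u-on , v-on) (u′≢v′ , u′-on , v′-on)
        with _ , _ , _ , _ , _ , _ , _ , only ← ends
        with only u∈ u-on | only v∈ v-on | only u′∈ u′-on | only v′∈ v′-on
      ... | inj₁ refl | inj₁ refl | _ | _ = ⊥-elim (u≢v (≡-vertex refl))
      ... | inj₂ refl | inj₂ refl | _ | _ = ⊥-elim (u≢v (≡-vertex refl))
      ... | _ | _ | inj₁ refl | inj₁ refl = ⊥-elim (u′≢v′ (≡-vertex refl))
      ... | _ | _ | inj₂ refl | inj₂ refl = ⊥-elim (u′≢v′ (≡-vertex refl))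
      ... | inj₁ refl | inj₂ refl | inj₁ refl | inj₂ refl = inj₁ (≡-vertex refl , ≡-vertex refl)
      ... | inj₁ refl | inj₂ refl | inj₂ refl | inj₁ refl = inj₂ (≡-vertex refl , ≡-vertex refl)
      ... | inj₂ refl | inj₁ refl | inj₁ refl | inj₂ refl = inj₂ (≡-vertex refl , ≡-vertex refl)
      ... | inj₂ refl | inj₁ refl | inj₂ refl | inj₁ refl = inj₁ (≡-vertex refl , ≡-vertex refl)

  Φ : Multigraph
  Φ = record
    { Vertex       = ΦVertex
    ; Edge         = TwoSwitch graph
    ; Joins        = ΦJoins
    ; joins-sym    = λ (u≢v , u-on , v-on) → (λ v≡u → u≢v (sym v≡u)) , v-on , u-on
    ; loopless     = λ (v≢v , _) → v≢v refl
    ; joins-exists = Φjoins-exists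
    ; joins-unique = λ {s} → Φjoins-unique s
    }

-- j is the cyclic successor of i among the indices 0, …, n−1.
Next : ∀ {n} → Fin n → Fin n → Set
Next {n} i j = toℕ j ≡ suc (toℕ i) ⊎ (suc (toℕ i) ≡ n × toℕ j ≡ 0)

record InducedCycle (M : Multigraph) : Set where
  open Multigraph M
  field
    length       : ℕ
    length≥3     : 3 ≤ length
    vertex       : Fin length → Vertex
    distinct     : Injective _≡_ _≡_ vertex
    consecutive  : ∀ {i j} → Next i j → Adjacent (vertex i) (vertex j)
    no-chord     : ∀ {i j} → i ≢ j → ¬ Next i j → ¬ Next j i →
                   ¬ Adjacent (vertex i) (vertex j)

{-# OPTIONS --safe #-}

-- Vertices u, v of Φ(S) are adjacent exactly when N u and N v are incomparable
-- for inclusion, so Φ(S) is the incomparability graph of a preorder ≲.  In such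
-- a graph, if x and y are adjacent and z is adjacent to neither, then z ≲ x
-- implies z ≲ y, and dually.  Let v₀, v₁, …, vₙ₋₁ be an induced cycle with n ≥ 5,
-- and say v₀ ≲ v₂.  Then v₀ ≲ v₃, v₁ ≲ v₃, v₁ ≲ v₄, v₂ ≲ v₄, and, moving along
-- the cycle, v₂ ≲ vₙ₋₁.  So v₀ ≲ vₙ₋₁, although v₀ and vₙ₋₁ are adjacent.
module Submission where

open import Defs
open import Data.Empty using (⊥-elim)
open import Data.Fin using (Fin; suc; fromℕ; inject₁; _<_)
open import Data.Fin.Induction using (<-weakInduction)
open import Data.Fin.Patterns using (0F; 1F; 2F; 3F)
open import Data.Fin.Properties using (any?; toℕ-fromℕ; toℕ-inject₁; <-cmp; <-trans)
open import Data.Fin.Subset using (_∈_; _∉_; _⊆_)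
open import Data.Fin.Subset.Properties using (_∈?_; ⊆-trans)
open import Data.Nat using (ℕ; _+_; _≤_; _<?_)
open import Data.Nat.Properties using (≮⇒≥; m≤n⇒∃[o]m+o≡n)
open import Data.Product using (∃; _×_; _,_; proj₁)
open import Data.Product.Properties using (Σ-≡,≡→≡)
open import Data.Sum using (_⊎_; inj₁; inj₂; swap)
open import Data.Vec.Properties.WithK using ([]=-irrelevant)
open import Function using (flip; _∘_)
open import Relation.Binary.Core using (Rel)
open import Relation.Binary.Definitions using (Transitive; tri<; tri≈; tri>)
open import Relation.Binary.PropositionalEquality using (_≡_; _≢_; refl; sym; cong)
open import Relation.Nullary using (¬_; yes; no; ¬?)
open import Relation.Nullary.Decidable using (_×-dec_; decidable-stable)

-- Cycles in the incomparability graph of a transitive relation.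

record IncomparabilityCycle {n ℓ} (_≲_ : Rel (Fin n) ℓ) : Set ℓ where
  field
    ≲-trans    : Transitive _≲_
    next⇒≴     : ∀ {i j} → Next i j → ¬ (i ≲ j)
    next⇒≵     : ∀ {i j} → Next i j → ¬ (j ≲ i)
    comparable : ∀ {i j} → i ≢ j → ¬ Next i j → ¬ Next j i → i ≲ j ⊎ j ≲ i

  -- Were `y ≲ z`, the chain `y ≲ z ≲ x` would contradict the hypothesis on `x` and `y`.
  slideʳ : ∀ {x y z} → ¬ (y ≲ x) → z ≲ y ⊎ y ≲ z → z ≲ x → z ≲ y
  slideʳ y≴x (inj₁ z≲y) z≲x = z≲y
  slideʳ y≴x (inj₂ y≲z) z≲x = ⊥-elim (y≴x (≲-trans y≲z z≲x))

  slideˡ : ∀ {x y z} → ¬ (x ≲ y) → y ≲ z ⊎ z ≲ y → x ≲ z → y ≲ z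
  slideˡ x≴y (inj₁ y≲z) x≲z = y≲z
  slideˡ x≴y (inj₂ z≲y) x≲z = ⊥-elim (x≴y (≲-trans x≲z z≲y))

-- Reversal exchanges the two conditions on `Next`. It turns the case `2F ≲ 0F` into the case
-- `0F ≲ 2F`.
converse : ∀ {n ℓ} {_≲_ : Rel (Fin n) ℓ} →
           IncomparabilityCycle _≲_ → IncomparabilityCycle (flip _≲_)
converse C = record
  { ≲-trans    = flip ≲-trans
  ; next⇒≴     = next⇒≵
  ; next⇒≵     = next⇒≴
  ; comparable = λ i≢j i↛j j↛i → swap (comparable i≢j i↛j j↛i)
  }
  where open IncomparabilityCycle C

pattern 4+ i = suc (suc (suc (suc i)))

module _ {k ℓ} {_≲_ : Rel (Fin (5 + k)) ℓ} (C : IncomparabilityCycle _≲_) where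
  open IncomparabilityCycle C

  0∼2 : 0F ≲ 2F ⊎ 2F ≲ 0F
  0∼2 = comparable (λ ()) (λ { (inj₁ ()) ; (inj₂ (() , _)) }) (λ { (inj₁ ()) ; (inj₂ (() , _)) })

  0∼3 : 0F ≲ 3F ⊎ 3F ≲ 0F
  -- The length matters here: an edge from `3F` back to `0F` would need `4 ≡ 5 + k`.
  0∼3 = comparable (λ ()) (λ { (inj₁ ()) ; (inj₂ (() , _)) }) (λ { (inj₁ ()) ; (inj₂ (() , _)) })

  1∼3 : 1F ≲ 3F ⊎ 3F ≲ 1F
  1∼3 = comparable (λ ()) (λ { (inj₁ ()) ; (inj₂ (() , _)) }) (λ { (inj₁ ()) ; (inj₂ (_ , ())) })

  1∼4 : 1F ≲ 4+ 0F ⊎ 4+ 0F ≲ 1F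
  1∼4 = comparable (λ ()) (λ { (inj₁ ()) ; (inj₂ (() , _)) }) (λ { (inj₁ ()) ; (inj₂ (_ , ())) })

  -- `4+ i` may be the last index, so the wrap-around is excluded by its target: the successor of
  -- the last index is `0F`, not `2F`. Hence the walk to the end of the cycle is compared with `2F`.
  2∼4+ : ∀ i → 2F ≲ 4+ i ⊎ 4+ i ≲ 2F
  2∼4+ i = comparable (λ ()) (λ { (inj₁ ()) ; (inj₂ (() , _)) }) (λ { (inj₁ ()) ; (inj₂ (_ , ())) })

  0≴2 : ¬ (0F ≲ 2F)
  -- `inj₂` is the closing edge, from the last index `4+ (fromℕ k)` to `0F`.
  0≴2 0≲2 = next⇒≵ (inj₂ (cong (5 +_) (toℕ-fromℕ k) , refl)) (≲-trans 0≲2 (2≲4+ (fromℕ k)))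
    where
    -- The right end always moves before the left one, so the two indices stay at distance two or
    -- three and remain comparable.
    0≲3 : 0F ≲ 3F
    0≲3 = slideʳ (next⇒≵ (inj₁ refl)) 0∼3 0≲2

    1≲3 : 1F ≲ 3F
    1≲3 = slideˡ (next⇒≴ (inj₁ refl)) 1∼3 0≲3

    1≲4 : 1F ≲ 4+ 0F
    1≲4 = slideʳ (next⇒≵ (inj₁ refl)) 1∼4 1≲3

    2≲4 : 2F ≲ 4+ 0F
    2≲4 = slideˡ (next⇒≴ (inj₁ refl)) (2∼4+ 0F) 1≲4

    2≲4+ : ∀ i → 2F ≲ 4+ i
    2≲4+ = <-weakInduction (λ i → 2F ≲ 4+ i) 2≲4 λ i →
      slideʳ (next⇒≵ (inj₁ (cong (5 +_) (sym (toℕ-inject₁ i))))) (2∼4+ (suc i))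

incomparabilityCycle≤4 : ∀ {n ℓ} {_≲_ : Rel (Fin n) ℓ} → IncomparabilityCycle _≲_ → n ≤ 4
incomparabilityCycle≤4 {n} C with 4 <? n
... | no 4≮n = ≮⇒≥ 4≮n
... | yes 5≤n with m≤n⇒∃[o]m+o≡n 5≤n
...   | _ , refl with 0∼2 C
...     | inj₁ 0≲2 = ⊥-elim (0≴2 C 0≲2)
...     | inj₂ 2≲0 = ⊥-elim (0≴2 (converse C) 2≲0)

-- Symmetries and canonical arrays of 2-switches.

module _ {m : ℕ} {G : Graph m} where
  open Graph G

  -- Together with `swapEdges` this generates the four arrays that denote one replacement.
  swapEnds : ∀ {a b c d} → IsTwoSwitch G a b c d → IsTwoSwitch G b a d c
  swapEnds w = record
    { a≢c = b≢d ; b≢d = a≢c ; ab∈E = ~-sym ab∈E ; cd∈E = ~-sym cd∈E ; ac∉E = bd∉E ; bd∉E = ac∉E }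
    where open IsTwoSwitch w

  swapEdges : ∀ {a b c d} → IsTwoSwitch G a b c d → IsTwoSwitch G c d a b
  swapEdges w = record
    { a≢c = a≢c ∘ sym ; b≢d = b≢d ∘ sym ; ab∈E = cd∈E ; cd∈E = ab∈E
    ; ac∉E = ac∉E ∘ ~-sym ; bd∉E = bd∉E ∘ ~-sym }
    where open IsTwoSwitch w

  ~⇒≢ : ∀ {u v} → u ~ v → u ≢ v
  ~⇒≢ u~v refl = ~-irrefl u~v

  first≢last : ∀ {a b c d} → IsTwoSwitch G a b c d → a ≢ d
  first≢last w refl = ac∉E (~-sym cd∈E)
    where open IsTwoSwitch w

  SwitchOn : Fin m → Fin m → Set
  SwitchOn u v = ∃ λ (s : TwoSwitch G) → TwoSwitch.ActsOn s u × TwoSwitch.ActsOn s v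

  module _ {a b c d : Fin m} (w : IsTwoSwitch G a b c d) where
    open IsTwoSwitch w

    least-a : a < b → a < c → a < d → SwitchOn a d
    least-a a<b a<c a<d = record { a-least = a<b , a<c , a<d ; valid = w } ,
      inj₁ refl , inj₂ (inj₂ (inj₂ refl))

    least-b : b < a → b < d → b < c → SwitchOn a d
    least-b b<a b<d b<c = record { a-least = b<a , b<d , b<c ; valid = swapEnds w } ,
      inj₂ (inj₁ refl) , inj₂ (inj₂ (inj₁ refl))

    least-c : c < d → c < a → c < b → SwitchOn a d
    least-c c<d c<a c<b = record { a-least = c<d , c<a , c<b ; valid = swapEdges w } ,
      inj₂ (inj₂ (inj₁ refl)) , inj₂ (inj₁ refl)

    least-d : d < c → d < b → d < a → SwitchOn a d
    least-d d<c d<b d<a = record { a-least = d<c , d<b , d<a ; valid = swapEdges (swapEnds w) } ,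
      inj₂ (inj₂ (inj₂ refl)) , inj₁ refl

    -- A `TwoSwitch` must begin with its least vertex, which `a` need not be. The smaller ends of
    -- the two edges are compared, and the symmetric array that begins with the least vertex is
    -- taken.
    switchOn : SwitchOn a d
    switchOn with <-cmp a b | <-cmp c d
    switchOn | tri≈ _ a≡b _ | _            = ⊥-elim (~⇒≢ ab∈E a≡b)
    switchOn | _            | tri≈ _ c≡d _ = ⊥-elim (~⇒≢ cd∈E c≡d)
    switchOn | tri< a<b _ _ | tri< c<d _ _ with <-cmp a c
    ... | tri< a<c _ _ = least-a a<b a<c (<-trans a<c c<d)
    ... | tri≈ _ a≡c _ = ⊥-elim (a≢c a≡c)
    ... | tri> _ _ c<a = least-c c<d c<a (<-trans c<a a<b)
    switchOn | tri< a<b _ _ | tri> _ _ d<c with <-cmp a d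
    ... | tri< a<d _ _ = least-a a<b (<-trans a<d d<c) a<d
    ... | tri≈ _ a≡d _ = ⊥-elim (first≢last w a≡d)
    ... | tri> _ _ d<a = least-d d<c (<-trans d<a a<b) d<a
    switchOn | tri> _ _ b<a | tri< c<d _ _ with <-cmp b c
    ... | tri< b<c _ _ = least-b b<a (<-trans b<c c<d) b<c
    ... | tri≈ _ b≡c _ = ⊥-elim (first≢last (swapEnds w) b≡c)
    ... | tri> _ _ c<b = least-c c<d (<-trans c<b b<a) c<b
    switchOn | tri> _ _ b<a | tri> _ _ d<c with <-cmp b d
    ... | tri< b<d _ _ = least-b b<a b<d (<-trans b<d d<c)
    ... | tri≈ _ b≡d _ = ⊥-elim (b≢d b≡d)
    ... | tri> _ _ d<b = least-d d<c d<b (<-trans d<b b<a)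

-- Adjacency in `Φ S` as incomparability of neighbourhoods.

module _ {m : ℕ} (S : SplitGraph m) where
  open SplitGraph S
  open Multigraph (Φ S) using (Adjacent; joins-sym)

  ∖-inhabited⊎⊆ : ∀ u v → (∃ λ x → x ∈ N u × x ∉ N v) ⊎ N u ⊆ N v
  ∖-inhabited⊎⊆ u v with any? (λ x → (x ∈? N u) ×-dec ¬? (x ∈? N v))
  ... | yes x∈u∖v  = inj₁ x∈u∖v
  ... | no  u∖v≡∅ = inj₂ λ {x} x∈u →
    decidable-stable (x ∈? N v) λ x∉v → u∖v≡∅ (x , x∈u , x∉v)

  N[I]⊆K : ∀ {u x} → u ∈ I → u ~ x → x ∈ K
  N[I]⊆K {x = x} u∈I u~x with cover x
  ... | inj₁ x∈K = x∈K
  ... | inj₂ x∈I = ⊥-elim (independent u∈I x∈I u~x)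

  I≢K : ∀ {u x} → u ∈ I → x ∈ K → u ≢ x
  I≢K u∈I x∈K refl = disjoint x∈K u∈I

  -- The vertex `b` is a witness: it lies in `N a`, and `x ~ b` is refuted at each position that `x`
  -- can take in the array.
  switch⇒⊈ : ∀ {a b c d x} → IsTwoSwitch graph a b c d → a ∈ I → x ∈ I → a ≢ x →
             x ≡ a ⊎ x ≡ b ⊎ x ≡ c ⊎ x ≡ d → ¬ (N a ⊆ N x)
  switch⇒⊈ w a∈I x∈I a≢x on a⊆x with a⊆x (IsTwoSwitch.ab∈E w) | on
  ... | x~b | inj₁ x≡a                = a≢x (sym x≡a)
  ... | x~b | inj₂ (inj₁ refl)        = ~-irrefl x~b
  -- If `x` is `c`, both `b` and `d` are neighbours of vertices of `I`, so they lie in `K`, and the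
  -- clique contains the forbidden edge `bd`.
  ... | x~b | inj₂ (inj₂ (inj₁ refl)) = bd∉E (clique (N[I]⊆K a∈I ab∈E) (N[I]⊆K x∈I cd∈E) b≢d)
    where open IsTwoSwitch w
  ... | x~b | inj₂ (inj₂ (inj₂ refl)) = IsTwoSwitch.bd∉E w (~-sym x~b)

  -- A symmetry of the array brings `u` to the first position, where `switch⇒⊈` applies.
  adjacent⇒⊈ : ∀ {u v} → Adjacent u v → ¬ (N (proj₁ u) ⊆ N (proj₁ v))
  adjacent⇒⊈ {u , u∈I} {v , v∈I} (s , u≢v , u-on , v-on) = go u-on v-on
    where
    open TwoSwitch s using (ActsOn)

    w : IsTwoSwitch graph _ _ _ _
    w = isTwoSwitch s

    u≢v′ : u ≢ v
    u≢v′ u≡v = u≢v (Σ-≡,≡→≡ (u≡v , []=-irrelevant _ _))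

    swapEndsOn : ∀ {a b c d x : Fin m} →
                 x ≡ a ⊎ x ≡ b ⊎ x ≡ c ⊎ x ≡ d → x ≡ b ⊎ x ≡ a ⊎ x ≡ d ⊎ x ≡ c
    swapEndsOn (inj₁ p)               = inj₂ (inj₁ p)
    swapEndsOn (inj₂ (inj₁ p))        = inj₁ p
    swapEndsOn (inj₂ (inj₂ (inj₁ p))) = inj₂ (inj₂ (inj₂ p))
    swapEndsOn (inj₂ (inj₂ (inj₂ p))) = inj₂ (inj₂ (inj₁ p))

    swapEdgesOn : ∀ {a b c d x : Fin m} →
                  x ≡ a ⊎ x ≡ b ⊎ x ≡ c ⊎ x ≡ d → x ≡ c ⊎ x ≡ d ⊎ x ≡ a ⊎ x ≡ b
    swapEdgesOn (inj₁ p)               = inj₂ (inj₂ (inj₁ p))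
    swapEdgesOn (inj₂ (inj₁ p))        = inj₂ (inj₂ (inj₂ p))
    swapEdgesOn (inj₂ (inj₂ (inj₁ p))) = inj₁ p
    swapEdgesOn (inj₂ (inj₂ (inj₂ p))) = inj₂ (inj₁ p)

    go : ActsOn u → ActsOn v → ¬ (N u ⊆ N v)
    go (inj₁ refl) on = switch⇒⊈ w u∈I v∈I u≢v′ on
    go (inj₂ (inj₁ refl)) on = switch⇒⊈ (swapEnds w) u∈I v∈I u≢v′ (swapEndsOn on)
    go (inj₂ (inj₂ (inj₁ refl))) on = switch⇒⊈ (swapEdges w) u∈I v∈I u≢v′ (swapEdgesOn on)
    go (inj₂ (inj₂ (inj₂ refl))) on =
      switch⇒⊈ (swapEdges (swapEnds w)) u∈I v∈I u≢v′ (swapEdgesOn (swapEndsOn on))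

  -- If both inclusions fail, take `x` in `N u` outside `N v` and `y` in `N v` outside `N u`.
  -- Replacing `ux`, `yv` with `uy`, `xv` is then a 2-switch, hence an edge of `Φ S` between `u` and
  -- `v`.
  nonadjacent⇒comparable : ∀ {u v} → u ≢ v → ¬ Adjacent u v →
                           N (proj₁ u) ⊆ N (proj₁ v) ⊎ N (proj₁ v) ⊆ N (proj₁ u)
  nonadjacent⇒comparable {u , u∈I} {v , v∈I} u≢v u≁v with ∖-inhabited⊎⊆ u v | ∖-inhabited⊎⊆ v u
  ... | inj₂ u⊆v | _ = inj₁ u⊆v
  ... | inj₁ _ | inj₂ v⊆u = inj₂ v⊆u
  ... | inj₁ (x , u~x , v≁x) | inj₁ (y , v~y , u≁y) =
    let s , u-on , v-on = switchOn w in ⊥-elim (u≁v (s , u≢v , u-on , v-on))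
    where
    w : IsTwoSwitch graph u x y v
    w = record
      { a≢c = I≢K u∈I (N[I]⊆K v∈I v~y) ; b≢d = I≢K v∈I (N[I]⊆K u∈I u~x) ∘ sym
      ; ab∈E = u~x ; cd∈E = ~-sym v~y ; ac∉E = u≁y ; bd∉E = v≁x ∘ ~-sym }

  incomparabilityCycle : (C : InducedCycle (Φ S)) → let open InducedCycle C in
    IncomparabilityCycle (λ i j → N (proj₁ (vertex i)) ⊆ N (proj₁ (vertex j)))
  incomparabilityCycle C = record
    { ≲-trans    = ⊆-trans
    ; next⇒≴     = λ i→j → adjacent⇒⊈ (consecutive i→j)
    ; next⇒≵     = λ i→j → let e , j = consecutive i→j in adjacent⇒⊈ (e , joins-sym {e} j)
    ; comparable = λ i≢j i↛j j↛i →
        nonadjacent⇒comparable (i≢j ∘ distinct) (no-chord i≢j i↛j j↛i)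
    }
    where open InducedCycle C

theorem3p3 : ∀ {m : ℕ} (S : SplitGraph m) (C : InducedCycle (Φ S)) → InducedCycle.length C ≤ 4
theorem3p3 S C = incomparabilityCycle≤4 (incomparabilityCycle S C)
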